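{- Let $\mathfrak M=(G,M,I,v)$ be a context-based model and let $\overline I=(G\times M)\setminus I$. Then: (a) $I$ and $\overline I$ are partial functions (from $G$ to $M$) iff $\mathfrak M\models_{s_1}\neg\Diamond^1_{\mathfrak p}\top_{s_2}$ and $\mathfrak M\models_{s_1}\neg\overline\Diamond^1_{\mathfrak p}\top_{s_2}$, respectively. (b) $I$ and $\overline I$ are functions iff $\mathfrak M\models_{s_1}\Diamond^1_{\mathfrak p}!\top_{s_2}$ and $\mathfrak M\models_{s_1}\overline\Diamond^1_{\mathfrak p}!\top_{s_2}$, respectively. (c) $I$ is an injective function iff $\mathfrak M\models_{s_1}\Diamond^1_{\mathfrak p}!\top_{s_2}$ and $\mathfrak M\models_{s_2}\neg\Diamond^1_{\mathfrak o}\top_{s_1}$. (d) $\overline I$ is an injective function iff $\mathfrak M\models_{s_1}\overline\Diamond^1_{\mathfrak p}!\top_{s_2}$ and $\mathfrak M\models_{s_2}\neg\overline\Diamond^1_{\mathfrak o}\top_{s_1}$. (e) $I$ is a surjective function iff $\mathfrak M\models_{s_1}\Diamond^1_{\mathfrak p}!\top_{s_2}$ and $\mathfrak M\models_{s_2}\Diamond^0_{\mathfrak o}\top_{s_1}$. (f) $\overline I$ is a surjective function iff $\mathfrak M\models_{s_1}\overline\Diamond^1_{\mathfrak p}!\top_{s_2}$ and $\mathfrak M\models_{s_2}\overline\Diamond^0_{\mathfrak o}\top_{s_1}$. (g) $I$ is a bijective function iff $\mathfrak M\models_{s_2}\Diamond^1_{\mathfrak o}!\top_{s_1}$ and $\mathfrak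 M\models_{s_1}\Diamond^1_{\mathfrak p}!\top_{s_2}$. (h) $\overline I$ is a bijective function iff $\mathfrak M\models_{s_2}\overline\Diamond^1_{\mathfrak o}!\top_{s_1}$ and $\mathfrak M\models_{s_1}\overline\Diamond^1_{\mathfrak p}!\top_{s_2}$.
   Context: A context is a triple $(G,M,I)$, $G,M$ sets, $I\subseteq G\times M$. A context-based model is $\mathfrak M=(G,M,I,v)$ where $v$ assigns to each propositional variable of sort $s_1$ a subset of $G$ and to each one of sort $s_2$ a subset of $M$ (the two sets of variables are disjoint). Graded formulas, for $n\in\mathbb N$ (including $0$): sort $s_1$: $\varphi::=p\mid\varphi\wedge\varphi\mid\varphi\vee\varphi\mid\neg\varphi\mid\Box^n_{\mathfrak p}\psi\mid\boxminus^n_{\mathfrak p}\psi$ with $\psi$ of sort $s_2$; sort $s_2$: $\psi::=q\mid\psi\wedge\psi\mid\psi\vee\psi\mid\neg\psi\mid\Box^n_{\mathfrak o}\varphi\mid\boxminus^n_{\mathfrak o}\varphi$ with $\varphi$ of sort $s_1$. $\top_{s_i}$ is verum of sort $s_i$. Sort-$s_1$ formulas are evaluated at $g\in G$, sort-$s_2$ formulas at $m\in M$. For $R\in\{I,\overline I\}$ let $R_{g\bullet}(\psi)=\{m\in M: Rgm,\ m\models\psi\}$ and $R_{\bullet m}(\varphi)=\{g\in G: Rgm,\ g\models\varphi\}$. Variables are interpreted by $v$, Boolean connectives classically, and: $m\models\Box^n_{\mathfrak o}\varphi$ iff $|I_{\bullet m}(\neg\varphi)|\le n$; $m\models\boxminus^n_{\mathfrak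 o}\varphi$ iff $|\overline I_{\bullet m}(\varphi)|\le n$; $g\models\Box^n_{\mathfrak p}\psi$ iff $|I_{g\bullet}(\neg\psi)|\le n$; $g\models\boxminus^n_{\mathfrak p}\psi$ iff $|\overline I_{g\bullet}(\psi)|\le n$. Derived modalities: $\overline\Box^n_{\mathfrak o}\varphi:=\boxminus^n_{\mathfrak o}\neg\varphi$, $\overline\Box^n_{\mathfrak p}\psi:=\boxminus^n_{\mathfrak p}\neg\psi$; $\Diamond^n_{\mathfrak o}\varphi:=\neg\Box^n_{\mathfrak o}\neg\varphi$, $\Diamond^n_{\mathfrak p}\psi:=\neg\Box^n_{\mathfrak p}\neg\psi$, $\overline\Diamond^n_{\mathfrak o}\varphi:=\neg\overline\Box^n_{\mathfrak o}\neg\varphi$, $\overline\Diamond^n_{\mathfrak p}\psi:=\neg\overline\Box^n_{\mathfrak p}\neg\psi$. For $n\ge1$ and $\Diamond$ any of these four diamonds, $\Diamond^n!\chi:=\Diamond^{n-1}\chi\wedge\neg\Diamond^n\chi$. $\mathfrak M\models_{s_i}\chi$ means that $\chi$ (of sort $s_i$) is satisfied at every point of sort $s_i$ of $\mathfrak M$. A relation $R\subseteq G\times M$ is a partial function if each $g\in G$ is $R$-related to at most one $m\in M$, and a function if each $g$ is related to exactly one $m$; injective, surjective, bijective refer to the function $G\to M$ so defined. -}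

module Defs where

open import Level using (Level; _⊔_; suc)
open import Data.Nat.Base using (ℕ; NonZero; pred)
open import Data.Fin.Base using (Fin)
open import Data.Product using (Σ; ∃!; proj₁)
open import Function.Base using (_∘_; flip)
open import Function.Bundles using (Injection)
open import Function.Definitions using (Injective; Surjective; Bijective)
open import Relation.Binary.Core using (REL)
open import Relation.Binary.PropositionalEquality using (_≡_; setoid)
import Relation.Binary.Construct.On as On
open import Relation.Nullary.Negation using (¬_)
open import Relation.Unary using (Pred; _∩_; _∪_; ∁)

private variable
  ν ℓ : Level

data Sort : Set where
  s₁ s₂ : Sort

-- V s is the set of propositional variables of sort s, so the two sets of
-- variables are disjoint by typing.
data Formula (V : Sort → Set ν) : Sort → Set ν where
  var     : ∀ {s} → V s → Formula V s
  _∧_ _∨_ : ∀ {s} → Formula V s → Formula V s → Formula V s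
  ∼_      : ∀ {s} → Formula V s → Formula V s
  □ₚ ⊟ₚ   : ℕ → Formula V s₂ → Formula V s₁
  □ₒ ⊟ₒ   : ℕ → Formula V s₁ → Formula V s₂

infix  9 ∼_
infixr 7 _∧_
infixr 6 _∨_

module _ {V : Sort → Set ν} where

  -- The grammar has no primitive constant for verum; it is the usual
  -- abbreviation x ∨ ¬ x, for any choice of variable x of the given sort.
  ⊤[_] : ∀ {s} → V s → Formula V s
  ⊤[ x ] = var x ∨ ∼ var x

  -- The superscript ᶜ stands for the overline.
  □ᶜₚ ◇ₚ ◇ᶜₚ : ℕ → Formula V s₂ → Formula V s₁
  □ᶜₚ n ψ = ⊟ₚ n (∼ ψ)
  ◇ₚ  n ψ = ∼ □ₚ n (∼ ψ)
  ◇ᶜₚ n ψ = ∼ □ᶜₚ n (∼ ψ)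

  □ᶜₒ ◇ₒ ◇ᶜₒ : ℕ → Formula V s₁ → Formula V s₂
  □ᶜₒ n φ = ⊟ₒ n (∼ φ)
  ◇ₒ  n φ = ∼ □ₒ n (∼ φ)
  ◇ᶜₒ n φ = ∼ □ᶜₒ n (∼ φ)

  -- exactly ◇ n χ is ◇ⁿ! χ.
  exactly : ∀ {s t} → (ℕ → Formula V s → Formula V t) →
            (n : ℕ) .{{_ : NonZero n}} → Formula V s → Formula V t
  exactly ◇ n χ = ◇ (pred n) χ ∧ ∼ ◇ n χ

-- |S| ≤ n: there is an injection from S to an n-element set. Elements of S are
-- compared by their underlying points, not by their membership proofs.
∣_∣≤_ : {A : Set ℓ} → Pred A ℓ → ℕ → Set ℓ
∣_∣≤_ {A = A} S n = Injection (On.setoid (setoid A) (proj₁ {B = S})) (setoid (Fin n))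

complement : {A B : Set ℓ} → REL A B ℓ → REL A B ℓ
complement R x y = ¬ R x y

record Model (V : Sort → Set ν) (ℓ : Level) : Set (ν ⊔ suc ℓ) where
  field
    G M : Set ℓ
    I   : REL G M ℓ
    v₁  : V s₁ → Pred G ℓ
    v₂  : V s₂ → Pred M ℓ

  Ī : REL G M ℓ
  Ī = complement I

  Point : Sort → Set ℓ
  Point s₁ = G
  Point s₂ = M

  -- The truth set of a formula.
  ⟦_⟧ : ∀ {s} → Formula V s → Pred (Point s) ℓ
  ⟦_⟧ {s₁} (var p) = v₁ p
  ⟦_⟧ {s₂} (var q) = v₂ q
  ⟦ χ ∧ χ′ ⟧ = ⟦ χ ⟧ ∩ ⟦ χ′ ⟧
  ⟦ χ ∨ χ′ ⟧ = ⟦ χ ⟧ ∪ ⟦ χ′ ⟧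
  ⟦ ∼ χ ⟧    = ∁ ⟦ χ ⟧
  ⟦ □ₚ n ψ ⟧ = λ g → ∣ I g ∩ ∁ ⟦ ψ ⟧ ∣≤ n
  ⟦ ⊟ₚ n ψ ⟧ = λ g → ∣ Ī g ∩ ⟦ ψ ⟧ ∣≤ n
  ⟦ □ₒ n φ ⟧ = λ m → ∣ flip I m ∩ ∁ ⟦ φ ⟧ ∣≤ n
  ⟦ ⊟ₒ n φ ⟧ = λ m → ∣ flip Ī m ∩ ⟦ φ ⟧ ∣≤ n

_⊨_ : {V : Sort → Set ν} (𝔐 : Model V ℓ) → ∀ {s} → Formula V s → Set ℓ
𝔐 ⊨ χ = ∀ x → ⟦ χ ⟧ x
  where open Model 𝔐

infix 4 _⊨_

module _ {A B : Set ℓ} (R : REL A B ℓ) where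

  IsPartialFunction : Set ℓ
  IsPartialFunction = ∀ x {y y′} → R x y → R x y′ → y ≡ y′

  IsFunction : Set ℓ
  IsFunction = ∀ x → ∃! _≡_ (R x)

  functionOf : IsFunction → A → B
  functionOf F = proj₁ ∘ F

  IsInjectiveFunction IsSurjectiveFunction IsBijectiveFunction : Set ℓ
  IsInjectiveFunction  = Σ IsFunction λ F → Injective  _≡_ _≡_ (functionOf F)
  IsSurjectiveFunction = Σ IsFunction λ F → Surjective _≡_ _≡_ (functionOf F)
  IsBijectiveFunction  = Σ IsFunction λ F → Bijective  _≡_ _≡_ (functionOf F)

{-# OPTIONS --safe #-}
-- As ⊤ holds everywhere, ◇ⁿ⊤ says of a point that more than n points are related
-- to it: zero and one are the cardinalities that tell non-emptiness and
-- uniqueness. The formula ◇ᶜ n χ unfolds to the truth condition of ◇ n χ with Ī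
-- for I, so each pair of claims is one claim about an arbitrary relation R.
module Submission where

open import Defs
open import Axiom.ExcludedMiddle using (ExcludedMiddle)
open import Data.Fin.Base using (Fin; zero)
open import Data.Nat.Base using (nonZero)
open import Data.Product using (_×_; _,_; proj₁; proj₂)
open import Data.Product.Function.NonDependent.Propositional using (_×-⇔_)
open import Data.Sum.Base using (inj₁; inj₂)
open import Function.Base using (_∘_; flip)
open import Function.Bundles using (_⇔_; mk⇔; Injection; module Equivalence)
open import Function.Construct.Composition using (_⇔-∘_)
open import Function.Definitions using (Injective; Surjective)
open import Level using (Level)
open import Relation.Binary.Core using (REL)
open import Relation.Binary.PropositionalEquality using (_≡_; refl; sym; trans; subst)
open import Relation.Nullary.Decidable.Core using (decidable-stable)
open import Relation.Nullary.Negation using (¬_; contradiction)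
open import Relation.Unary using (Pred; _∩_; _∪_; ∁; Universal; Empty; Satisfiable)

open Equivalence using (to; from)

private variable
  ℓ : Level

-- Both kinds of diamond put `⊤[ x ]` under two complements: `◇ₚ` by its inner `∼` and the `∁` in
-- the clause for `□ₚ`, `◇ᶜₚ` by two `∼`. The doubly negated form holds at every point
-- constructively.
¬¬-excluded-middle : {A : Set ℓ} (P : Pred A ℓ) → Universal (∁ (∁ (P ∪ ∁ P)))
¬¬-excluded-middle P x k = k (inj₂ (k ∘ inj₁))

module _ {A : Set ℓ} (S : Pred A ℓ) {U : Pred A ℓ} (univ : Universal U) where

  ∣∩∣≤0⇔empty : ∣ S ∩ U ∣≤ 0 ⇔ Empty S
  ∣∩∣≤0⇔empty = mk⇔ empty inject
    where
    empty : ∣ S ∩ U ∣≤ 0 → Empty S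
    empty f x Sx with () ← Injection.to f (x , Sx , univ x)

    inject : Empty S → ∣ S ∩ U ∣≤ 0
    inject ¬S = record
      { to        = λ (x , Sx , _) → contradiction Sx (¬S x)
      ; cong      = λ {(x , Sx , _)} → contradiction Sx (¬S x)
      ; injective = λ {(x , Sx , _)} → contradiction Sx (¬S x)
      }

  -- An injection into `Fin 1` identifies all its arguments, and its source setoid compares
  -- underlying points, so the points themselves are identified.
  ∣∩∣≤1⇔unique : ∣ S ∩ U ∣≤ 1 ⇔ (∀ {x y} → S x → S y → x ≡ y)
  ∣∩∣≤1⇔unique = mk⇔ unique inject
    where
    unique : ∣ S ∩ U ∣≤ 1 → ∀ {x y} → S x → S y → x ≡ y
    unique f {x} {y} Sx Sy =
      Injection.injective f {x , Sx , univ x} {y , Sy , univ y} (Fin1-prop _ _)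
      where
      Fin1-prop : (i j : Fin 1) → i ≡ j
      Fin1-prop zero zero = refl

    inject : (∀ {x y} → S x → S y → x ≡ y) → ∣ S ∩ U ∣≤ 1
    inject uniq = record
      { to        = λ _ → zero
      ; cong      = λ _ → refl
      ; injective = λ {(_ , Sx , _)} {(_ , Sy , _)} _ → uniq Sx Sy
      }

IsTotal : {A B : Set ℓ} → REL A B ℓ → Set ℓ
IsTotal R = ∀ x → Satisfiable (R x)

-- Existence and uniqueness are separated because the two conjuncts of `exactly ◇ 1` express them
-- one each.
isFunction⇔ : {A B : Set ℓ} (R : REL A B ℓ) →
              IsFunction R ⇔ (IsTotal R × IsPartialFunction R)
isFunction⇔ R = mk⇔ (λ F → total F , partial F) function
  where
  total : IsFunction R → IsTotal R
  total F x with y , Rxy , _ ← F x = y , Rxy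

  partial : IsFunction R → IsPartialFunction R
  partial F x Rxy Rxy′ with _ , _ , uniq ← F x = trans (sym (uniq Rxy)) (uniq Rxy′)

  function : IsTotal R × IsPartialFunction R → IsFunction R
  function (tot , part) x with y , Rxy ← tot x = y , Rxy , part x Rxy

module _ {A B : Set ℓ} {R : REL A B ℓ} (F : IsFunction R) where

  private
    f : A → B
    f = functionOf R F

    Rxfx : ∀ x → R x (f x)
    Rxfx x = proj₁ (proj₂ (F x))

    f-unique : ∀ {x y} → R x y → f x ≡ y
    f-unique {x} = proj₂ (proj₂ (F x))

  -- As `R` is the graph of `f`, the points related to `y` form the fibre of `f` over `y`.
  -- Injectivity bounds each fibre by one point; surjectivity makes each one inhabited.
  injective⇔ : Injective _≡_ _≡_ f ⇔ IsPartialFunction (flip R)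
  injective⇔ = mk⇔ ⇒ ⇐
    where
    ⇒ : Injective _≡_ _≡_ f → IsPartialFunction (flip R)
    ⇒ inj _ Rxy Rx′y = inj (trans (f-unique Rxy) (sym (f-unique Rx′y)))

    ⇐ : IsPartialFunction (flip R) → Injective _≡_ _≡_ f
    ⇐ part {x} {x′} fx≡fx′ = part (f x′) (subst (R x) fx≡fx′ (Rxfx x)) (Rxfx x′)

  surjective⇔ : Surjective _≡_ _≡_ f ⇔ IsTotal (flip R)
  surjective⇔ = mk⇔ ⇒ ⇐
    where
    ⇒ : Surjective _≡_ _≡_ f → IsTotal (flip R)
    -- `Surjective` gives `f z ≡ y` for all `z` equal to the chosen preimage; `refl` takes `z` to be
    -- that preimage.
    ⇒ surj y with x , fx≡y ← surj y = x , subst (R x) (fx≡y refl) (Rxfx x)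

    ⇐ : IsTotal (flip R) → Surjective _≡_ _≡_ f
    ⇐ tot y with x , Rxy ← tot y = x , λ { refl → f-unique Rxy }

module _ {A B : Set ℓ} (R : REL A B ℓ) where

  isInjectiveFunction⇔ : IsInjectiveFunction R ⇔ (IsFunction R × IsPartialFunction (flip R))
  isInjectiveFunction⇔ = mk⇔
    (λ (F , inj) → F , to (injective⇔ F) inj)
    (λ (F , part) → F , from (injective⇔ F) part)

  isSurjectiveFunction⇔ : IsSurjectiveFunction R ⇔ (IsFunction R × IsTotal (flip R))
  isSurjectiveFunction⇔ = mk⇔
    (λ (F , surj) → F , to (surjective⇔ F) surj)
    (λ (F , tot) → F , from (surjective⇔ F) tot)

  -- Injectivity and surjectivity are uniqueness and existence for the converse relation, so
  -- together they make it a function.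
  isBijectiveFunction⇔ : IsBijectiveFunction R ⇔ (IsFunction (flip R) × IsFunction R)
  isBijectiveFunction⇔ = mk⇔
    (λ (F , inj , surj) →
      from (isFunction⇔ (flip R)) (to (surjective⇔ F) surj , to (injective⇔ F) inj) , F)
    (λ (F˘ , F) → let tot , part = to (isFunction⇔ (flip R)) F˘ in
      F , from (injective⇔ F) part , from (surjective⇔ F) tot)

-- The truth conditions of ◇⁰⊤, ¬◇¹⊤ and ◇¹!⊤, with U the truth set of ¬¬⊤.
module _ (em : ExcludedMiddle ℓ) {A B : Set ℓ} (R : REL A B ℓ)
         {U : Pred B ℓ} (univ : Universal U) where

  isTotal⇔ : IsTotal R ⇔ (∀ x → ¬ ∣ R x ∩ U ∣≤ 0)
  isTotal⇔ = mk⇔ ⇒ ⇐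
    where
    ⇒ : IsTotal R → ∀ x → ¬ ∣ R x ∩ U ∣≤ 0
    ⇒ tot x ≤0 with y , Rxy ← tot x = to (∣∩∣≤0⇔empty (R x) univ) ≤0 y Rxy

    ⇐ : (∀ x → ¬ ∣ R x ∩ U ∣≤ 0) → IsTotal R
    -- The assumption only refutes emptiness; excluded middle turns this into a related point.
    ⇐ ≰0 x = decidable-stable em λ ¬∃ →
      ≰0 x (from (∣∩∣≤0⇔empty (R x) univ) λ y Rxy → ¬∃ (y , Rxy))

  isPartialFunction⇔ : IsPartialFunction R ⇔ (∀ x → ¬ ¬ ∣ R x ∩ U ∣≤ 1)
  isPartialFunction⇔ = mk⇔ ⇒ ⇐
    where
    ⇒ : IsPartialFunction R → ∀ x → ¬ ¬ ∣ R x ∩ U ∣≤ 1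
    ⇒ part x ≰1 = ≰1 (from (∣∩∣≤1⇔unique (R x) univ) (part x))

    ⇐ : (∀ x → ¬ ¬ ∣ R x ∩ U ∣≤ 1) → IsPartialFunction R
    -- Negating a diamond leaves the bound doubly negated; excluded middle strips this before the
    -- bound is read as uniqueness.
    ⇐ ≤1 x = to (∣∩∣≤1⇔unique (R x) univ) (decidable-stable em (≤1 x))

  isFunction⇔exactly-one :
    IsFunction R ⇔ (∀ x → (¬ ∣ R x ∩ U ∣≤ 0) × (¬ ¬ ∣ R x ∩ U ∣≤ 1))
  isFunction⇔exactly-one =
    -- `exactly` conjoins inside one formula, so two universal statements become one universal
    -- statement of pairs.
    mk⇔ (λ (f , g) x → f x , g x) (λ h → proj₁ ∘ h , proj₂ ∘ h)
      ⇔-∘ ((isTotal⇔ ×-⇔ isPartialFunction⇔) ⇔-∘ isFunction⇔ R)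

theorem6p6 : {ν ℓ : Level} → ExcludedMiddle ℓ →
    {V : Sort → Set ν} (p : V s₁) (q : V s₂) (𝔐 : Model V ℓ) →
    let open Model 𝔐 in
    (IsPartialFunction I ⇔ (𝔐 ⊨ ∼ ◇ₚ 1 ⊤[ q ]))
    × (IsPartialFunction Ī ⇔ (𝔐 ⊨ ∼ ◇ᶜₚ 1 ⊤[ q ]))
    × (IsFunction I ⇔ (𝔐 ⊨ exactly ◇ₚ 1 ⊤[ q ]))
    × (IsFunction Ī ⇔ (𝔐 ⊨ exactly ◇ᶜₚ 1 ⊤[ q ]))
    × (IsInjectiveFunction I ⇔ ((𝔐 ⊨ exactly ◇ₚ 1 ⊤[ q ]) × (𝔐 ⊨ ∼ ◇ₒ 1 ⊤[ p ])))
    × (IsInjectiveFunction Ī ⇔ ((𝔐 ⊨ exactly ◇ᶜₚ 1 ⊤[ q ]) × (𝔐 ⊨ ∼ ◇ᶜₒ 1 ⊤[ p ])))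
    × (IsSurjectiveFunction I ⇔ ((𝔐 ⊨ exactly ◇ₚ 1 ⊤[ q ]) × (𝔐 ⊨ ◇ₒ 0 ⊤[ p ])))
    × (IsSurjectiveFunction Ī ⇔ ((𝔐 ⊨ exactly ◇ᶜₚ 1 ⊤[ q ]) × (𝔐 ⊨ ◇ᶜₒ 0 ⊤[ p ])))
    × (IsBijectiveFunction I ⇔ ((𝔐 ⊨ exactly ◇ₒ 1 ⊤[ p ]) × (𝔐 ⊨ exactly ◇ₚ 1 ⊤[ q ])))
    × (IsBijectiveFunction Ī ⇔ ((𝔐 ⊨ exactly ◇ᶜₒ 1 ⊤[ p ]) × (𝔐 ⊨ exactly ◇ᶜₚ 1 ⊤[ q ])))
theorem6p6 em p q 𝔐 =
    isPartialFunction⇔ em I ⊤₂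
  , isPartialFunction⇔ em Ī ⊤₂
  , isFunction⇔exactly-one em I ⊤₂
  , isFunction⇔exactly-one em Ī ⊤₂
  -- Formulas of sort `s₂` count the points related to a given `m`, so they are conditions on the
  -- converse relation, with the verum of sort `s₁`.
  , (isFunction⇔exactly-one em I ⊤₂ ×-⇔ isPartialFunction⇔ em (flip I) ⊤₁) ⇔-∘ isInjectiveFunction⇔ I
  , (isFunction⇔exactly-one em Ī ⊤₂ ×-⇔ isPartialFunction⇔ em (flip Ī) ⊤₁) ⇔-∘ isInjectiveFunction⇔ Ī
  , (isFunction⇔exactly-one em I ⊤₂ ×-⇔ isTotal⇔ em (flip I) ⊤₁) ⇔-∘ isSurjectiveFunction⇔ I
  , (isFunction⇔exactly-one em Ī ⊤₂ ×-⇔ isTotal⇔ em (flip Ī) ⊤₁) ⇔-∘ isSurjectiveFunction⇔ Ī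
  , (isFunction⇔exactly-one em (flip I) ⊤₁ ×-⇔ isFunction⇔exactly-one em I ⊤₂) ⇔-∘ isBijectiveFunction⇔ I
  , (isFunction⇔exactly-one em (flip Ī) ⊤₁ ×-⇔ isFunction⇔exactly-one em Ī ⊤₂) ⇔-∘ isBijectiveFunction⇔ Ī
  where
  open Model 𝔐
  ⊤₁ = ¬¬-excluded-middle (v₁ p)
  ⊤₂ = ¬¬-excluded-middle (v₂ q)
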